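{- The reduced logogram $|Log_{CNF}(SAT)|$ is irreducible. That is, for all positive integers $n, m$, writing $E = CNF^{nm}$ and $F = SAT^{nm}$, the set $|Log_E(F)|$ is complete for $(E,F)$ and no proper subset of $|Log_E(F)|$ is complete for $(E,F)$.
   Context: Let $\Sigma$ be a finite alphabet and $N$ the set of positive integers. A string over $\Sigma$ is a partial function $N \to \Sigma$ with finite domain; $\Sigma_\infty$ is the set of all strings. A word over $\Sigma$ is identified with the string whose domain is an initial segment $\{1,\dots,\ell\}$ of $N$. For strings $f, g$, write $f \le g$ (equivalently $g \ge f$; "$g$ includes $f$") if $Dom(f) \subseteq Dom(g)$ and $g$ agrees with $f$ on $Dom(f)$. For a set of words $E$, $\Sigma_\infty(E)$ is the set of strings $g$ such that some $x \in E$ satisfies $x \ge g$. For $H \subseteq \Sigma_\infty(E)$, $E^H = \{x \in E : \exists a \in H,\ x \ge a\}$. For $F \subseteq E$ the logogram is $Log_E(F) = \{g \in \Sigma_\infty(E) : \forall x \in E\ (x \ge g \Rightarrow x \in E^F)\}$, where $F$ is viewed as a set of strings. The reduced logogram $|Log_E(F)|$ is the set of $\le$-minimal elements of $Log_E(F)$, i.e. those that do not include any other element of $Log_E(F)$. A set $H \subseteq |Log_E(F)|$ is complete for $(E,F)$ if for every $x \in E$: $x \in F \Leftrightarrow \exists f \in H\ (f \le x)$. A complete set $H$ is irreducible for $(E,F)$ if no proper subset of $H$ is complete for $(E,F)$. Encoding of CNF: $\Sigma = \{0,1,2\}$. A clause over variables $v_1,\dots,v_n$ is encoded as a word of length $n$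 over $\Sigma$, where the $k$-th letter is $0$ if $v_k$ does not occur, $1$ if the literal $v_k$ occurs, $2$ if the literal $\neg v_k$ occurs. A formula with $n$ variables and $m$ clauses is encoded as the concatenation of its $m$ clause codes. $CNF^{nm}$ is the set of all words of length $nm$ over $\{0,1,2\}$, each regarded as such a formula (an all-zero block is the empty, hence unsatisfiable, clause), and $SAT^{nm}$ is the set of those words in $CNF^{nm}$ encoding satisfiable formulas. -}

module Defs where

open import Data.Bool using (Bool; not; T)
open import Data.Fin using (Fin)
open import Data.Fin.Patterns using (1F; 2F)
open import Data.List using (List; []; _∷_; length; upTo)
import Data.List.Membership.Propositional as List
open import Data.List.Membership.Propositional.Properties using (∈-upTo⁺)
open import Data.Maybe using (Maybe; just; nothing; Is-just)
open import Data.Nat using (ℕ; zero; suc; _*_; _<_; z<s; s<s)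
open import Data.Product using (_×_; ∃-syntax)
open import Data.Vec using (Vec; lookup; concat; toList)
open import Data.Vec.Relation.Unary.All using (All)
open import Function using (_⇔_)
open import Level using (0ℓ)
open import Relation.Binary using (_Respects_)
open import Relation.Binary.PropositionalEquality using (_≡_)
open import Relation.Nullary using (¬_)
open import Relation.Unary using (Pred; _∈_; _⊆_; _⊂_)

private
  variable
    A : Set

-- The index k : ℕ stands for the position k + 1 of a string, so that positions
-- range over the positive integers.
record Str (A : Set) : Set where
  field
    at      : ℕ → Maybe A
    support : List ℕ
    finite  : ∀ {k} → Is-just (at k) → k List.∈ support

open Str public using (at)

Dom : Str A → Pred ℕ 0ℓ
Dom f k = Is-just (at f k)

infix 4 _≈_ _≤_

-- Equality of partial functions; the enumeration `support` carries no
-- information beyond the finiteness of the domain.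
_≈_ : Str A → Str A → Set
f ≈ g = ∀ k → at f k ≡ at g k

_≤_ : Str A → Str A → Set
f ≤ g = Dom f ⊆ Dom g × (∀ {k} → k ∈ Dom f → at g k ≡ at f k)

letterAt : List A → ℕ → Maybe A
letterAt []       _       = nothing
letterAt (a ∷ _)  zero    = just a
letterAt (_ ∷ as) (suc k) = letterAt as k

letterAt-< : (w : List A) (k : ℕ) → Is-just (letterAt w k) → k < length w
letterAt-< (_ ∷ _) zero    _ = z<s
letterAt-< (_ ∷ w) (suc k) p = s<s (letterAt-< w k p)

⌜_⌝ : List A → Str A
⌜ w ⌝ = record
  { at      = letterAt w
  ; support = upTo (length w)
  ; finite  = λ {k} p → ∈-upTo⁺ (letterAt-< w k p)
  }

Words : Set → Set₁
Words A = Pred (List A) 0ℓ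

Strings : Set → Set₁
Strings A = Pred (Str A) 0ℓ

asStrings : Words A → Strings A
asStrings F g = ∃[ x ] x ∈ F × g ≈ ⌜ x ⌝

Σ∞ : Words A → Strings A
Σ∞ E g = ∃[ x ] x ∈ E × g ≤ ⌜ x ⌝

infix 8 _^_

_^_ : Words A → Strings A → Words A
(E ^ H) x = x ∈ E × ∃[ a ] a ∈ H × a ≤ ⌜ x ⌝

Log : Words A → Words A → Strings A
Log E F g = g ∈ Σ∞ E × (∀ {x} → x ∈ E → g ≤ ⌜ x ⌝ → x ∈ E ^ asStrings F)

ReducedLog : Words A → Words A → Strings A
ReducedLog E F g = g ∈ Log E F × (∀ {h} → h ∈ Log E F → h ≤ g → h ≈ g)

Complete : Words A → Words A → Strings A → Set
Complete E F H =
  H ⊆ ReducedLog E F × (∀ {x} → x ∈ E → x ∈ F ⇔ (∃[ f ] f ∈ H × f ≤ ⌜ x ⌝))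

-- A set of strings is a predicate respecting _≈_: a predicate that tells
-- apart two representations of one string is not a subset in the intended sense.
Irreducible : Words A → Words A → Strings A → Set₁
Irreducible E F H =
  Complete E F H ×
  (∀ (K : Strings _) → K Respects _≈_ → K ⊂ H → ¬ Complete E F K)

-- Letter 0: the variable does not occur; 1: it occurs positively; 2: negated.
Clause : ℕ → Set
Clause n = Vec (Fin 3) n

Formula : ℕ → ℕ → Set
Formula n m = Vec (Clause n) m

encode : ∀ {n m} → Formula n m → List (Fin 3)
encode φ = toList (concat φ)

data Literal (n : ℕ) : Set where
  pos neg : Fin n → Literal n

OccursIn : ∀ {n} → Clause n → Literal n → Set
OccursIn c (pos k) = lookup c k ≡ 1F
OccursIn c (neg k) = lookup c k ≡ 2F

Assignment : ℕ → Set
Assignment n = Fin n → Bool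

value : ∀ {n} → Assignment n → Literal n → Bool
value a (pos k) = a k
value a (neg k) = not (a k)

SatisfiesClause : ∀ {n} → Assignment n → Clause n → Set
SatisfiesClause a c = ∃[ l ] OccursIn c l × T (value a l)

Satisfiable : ∀ {n m} → Formula n m → Set
Satisfiable {n} φ = ∃[ a ] All (SatisfiesClause {n} a) φ

CNF : ℕ → ℕ → Words (Fin 3)
CNF n m x = length x ≡ n * m

SAT : ℕ → ℕ → Words (Fin 3)
SAT n m x = x ∈ CNF n m × (∃[ φ ] x ≡ encode {n} {m} φ × Satisfiable φ)

{-# OPTIONS --safe #-}
-- Turning a letter 0 into a literal keeps a formula satisfiable, so a string
-- lies in the logogram iff its completion by zeros is satisfiable, and a
-- minimal such string has no letter 0.  If g and f are minimal and f is
-- included in the completion of g by zeros, then f, having no zeros, is included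
-- in g, whence f = g: this completion is covered by g alone, and g cannot be
-- dropped.  For completeness, keep one true literal per clause of a satisfied
-- formula: emptying any of these positions leaves a completion with an empty
-- clause, so the result is minimal.
module Submission where

open import Defs
open import Data.Fin using (Fin; toℕ; fromℕ<; combine)
open import Data.Fin.Patterns using (0F)
open import Data.Fin.Properties
  using (any?; toℕ-fromℕ<; toℕ-injective; combine-injective; combine-surjective)
  renaming (_≟_ to _≟ᶠ_)
open import Data.List using (List; length)
open import Data.Maybe using (Maybe; just; nothing; Is-just; fromMaybe; _>>=_)
open import Data.Maybe.Properties using (just-injective)
open import Data.Maybe.Relation.Unary.Any using (just)
open import Data.Nat using (ℕ; _*_; _<_; NonZero)
open import Data.Nat.Properties using (*-comm) renaming (_≟_ to _≟ⁿ_)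
open import Data.Product using (_×_; _,_; proj₁; proj₂; ∃-syntax; ∃₂)
open import Data.Unit using (tt)
open import Data.Vec as Vec using (Vec; lookup; toList; concat; tabulate; replicate; fromList; cast; group)
open import Data.Vec.Properties
  using (lookup-concat; lookup-replicate; lookup∘tabulate; length-toList; toList-cast; toList∘fromList)
open import Data.Vec.Relation.Unary.All.Properties using (lookup⁺; lookup⁻)
open import Function using (mk⇔; Equivalence)
open import Relation.Binary.PropositionalEquality
  using (_≡_; _≢_; refl; sym; trans; cong; subst; module ≡-Reasoning)
open import Relation.Nullary using (Dec; yes; no; contradiction)
open import Relation.Nullary.Decidable using (¬?)
open import Relation.Unary using (_∈_)

private
  variable
    A : Set
    n m : ℕ

-- The inclusion order and restriction of strings.

≤-intro : ∀ (f g : Str A) → (∀ {k a} → at f k ≡ just a → at g k ≡ just a) → f ≤ g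
≤-intro f g agree = dom , same
  where
  dom : ∀ {k} → k ∈ Dom f → k ∈ Dom g
  dom {k} p with at f k in eq
  dom {k} (just _) | just a = subst Is-just (sym (agree eq)) (just tt)
  same : ∀ {k} → k ∈ Dom f → at g k ≡ at f k
  same {k} p with at f k in eq
  same {k} (just _) | just a = agree eq

≤-elim : ∀ (f g : Str A) → f ≤ g → ∀ {k a} → at f k ≡ just a → at g k ≡ just a
≤-elim f g (_ , same) eq = trans (same (subst Is-just (sym eq) (just tt))) eq

≤-trans : ∀ (f g h : Str A) → f ≤ g → g ≤ h → f ≤ h
≤-trans f g h f≤g g≤h = ≤-intro f h λ eq → ≤-elim g h g≤h (≤-elim f g f≤g eq)

≤-antisym : ∀ (f g : Str A) → f ≤ g → g ≤ f → f ≈ g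
≤-antisym f g f≤g g≤f k with at f k in eqf | at g k in eqg
... | just a  | _       = sym (trans (sym eqg) (≤-elim f g f≤g eqf))
... | nothing | just b  = trans (sym eqf) (≤-elim g f g≤f eqg)
... | nothing | nothing = refl

Σ∞-≤ : ∀ {E : Words A} (f g : Str A) → f ≤ g → g ∈ Σ∞ E → f ∈ Σ∞ E
Σ∞-≤ f g f≤g (x , x∈E , g≤x) = x , x∈E , ≤-trans f g ⌜ x ⌝ f≤g g≤x

module _ {P : ℕ → A → Set} (P? : ∀ k a → Dec (P k a)) where

  -- The test sees both position and letter, so one construction serves to delete zeros and to
  -- retain selected positions.
  keep : ℕ → A → Maybe A
  keep k a with P? k a
  ... | yes _ = just a
  ... | no  _ = nothing

  restrict : Str A → Str A
  restrict f = record
    { at      = λ k → at f k >>= keep k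
    ; support = Str.support f
    ; finite  = λ {k} p → Str.finite f (dom k p)
    }
    where
    dom : ∀ k → Is-just (at f k >>= keep k) → Is-just (at f k)
    dom k p with at f k
    ... | just _ = just tt

  restrict⁺ : ∀ f {k a} → at f k ≡ just a → P k a → at (restrict f) k ≡ just a
  restrict⁺ f {k} {a} eq p rewrite eq with P? k a
  ... | yes _ = refl
  ... | no ¬p = contradiction p ¬p

  restrict⁻ : ∀ f {k a} → at (restrict f) k ≡ just a → at f k ≡ just a × P k a
  restrict⁻ f {k} eq with at f k
  ... | just b with P? k b
  restrict⁻ f refl | just b | yes p = refl , p

  restrict-≤ : ∀ f → restrict f ≤ f
  restrict-≤ f = ≤-intro (restrict f) f λ eq → proj₁ (restrict⁻ f eq)

  -- The restriction lies below `f`, so minimality makes it equal to `f`: nothing was deleted, and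
  -- every letter passes the test.
  ReducedLog-restrict : ∀ {E F : Words A} f → f ∈ ReducedLog E F →
    restrict f ∈ Log E F → ∀ {k a} → at f k ≡ just a → P k a
  ReducedLog-restrict f (_ , minimal) log {k} eq =
    proj₂ (restrict⁻ f (trans (minimal {restrict f} log (restrict-≤ f) k) eq))

-- Words as formulas: positions, decoding and completion.

letterAt-length : (w : List A) {k : ℕ} {a : A} → letterAt w k ≡ just a → k < length w
letterAt-length w {k} eq = letterAt-< w k (subst Is-just (sym eq) (just tt))

letterAt-toList : (v : Vec A n) (i : Fin n) → letterAt (toList v) (toℕ i) ≡ just (lookup v i)
letterAt-toList (_ Vec.∷ _) 0F          = refl
letterAt-toList (_ Vec.∷ v) (Fin.suc i) = letterAt-toList v i

letter : Formula n m → Fin m → Fin n → Fin 3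
letter φ j i = lookup (lookup φ j) i

position : Fin m → Fin n → ℕ
position j i = toℕ (combine j i)

at-position : (φ : Formula n m) (j : Fin m) (i : Fin n) →
              at ⌜ encode φ ⌝ (position j i) ≡ just (letter φ j i)
at-position φ j i =
  trans (letterAt-toList (concat φ) (combine j i)) (cong just (lookup-concat φ j i))

position-injective : (j j′ : Fin m) (i i′ : Fin n) →
                     position j i ≡ position j′ i′ → j ≡ j′ × i ≡ i′
position-injective j j′ i i′ eq = combine-injective j i j′ i′ (toℕ-injective eq)

position-surjective : ∀ {k} → k < m * n → ∃₂ λ (j : Fin m) (i : Fin n) → position j i ≡ k
position-surjective {m} k<mn with j , i , eq ← combine-surjective {m} (fromℕ< k<mn) =
  j , i , trans (cong toℕ eq) (toℕ-fromℕ< k<mn)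

encode∈CNF : (φ : Formula n m) → encode φ ∈ CNF n m
encode∈CNF {n} {m} φ = trans (length-toList (concat φ)) (*-comm m n)

decode : ∀ x → x ∈ CNF n m → ∃[ φ ] x ≡ encode {n} {m} φ
decode {n} {m} x x∈E
  with φ , eq ← group m n (cast (trans x∈E (*-comm n m)) (fromList x)) = φ , (begin
    x                                 ≡⟨ toList∘fromList x ⟨
    toList (fromList x)               ≡⟨ toList-cast _ (fromList x) ⟨
    toList (cast _ (fromList x))      ≡⟨ cong toList eq ⟩
    encode φ                          ∎)
  where open ≡-Reasoning

-- The formula supplies the letters where `f` is undefined. With `empty` this is completion by
-- zeros; other formulas serve in showing that zeros can be deleted.
complete : Str (Fin 3) → Formula n m → Formula n m
complete f φ = tabulate λ j → tabulate λ i → fromMaybe (letter φ j i) (at f (position j i))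

letter-complete : ∀ f (φ : Formula n m) j i →
                  letter (complete f φ) j i ≡ fromMaybe (letter φ j i) (at f (position j i))
letter-complete f φ j i = trans
  (cong (λ c → lookup c i) (lookup∘tabulate _ j))
  (lookup∘tabulate (λ i → fromMaybe (letter φ j i) (at f (position j i))) i)

empty : Formula n m
empty = replicate _ (replicate _ 0F)

letter-empty : (j : Fin m) (i : Fin n) → letter empty j i ≡ 0F
letter-empty j i =
  trans (cong (λ c → lookup c i) (lookup-replicate j _)) (lookup-replicate i 0F)

-- The filler is 0, so any other letter comes from `f`.
complete-empty-nonzero : ∀ f (j : Fin m) (i : Fin n) {a} → letter (complete f empty) j i ≡ a →
                         a ≢ 0F → at f (position j i) ≡ just a
complete-empty-nonzero f j i eq a≢0
  with at f (position j i) | trans (sym (letter-complete f empty j i)) eq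
... | just b  | refl = refl
... | nothing | eq′  = contradiction (trans (sym eq′) (letter-empty j i)) a≢0

-- Literals and satisfiability.

var : Literal n → Fin n
var (pos i) = i
var (neg i) = i

occursIn⇒nonzero : ∀ (c : Clause n) l → OccursIn c l → lookup c (var l) ≢ 0F
occursIn⇒nonzero c (pos i) eq eq0 with () ← trans (sym eq) eq0
occursIn⇒nonzero c (neg i) eq eq0 with () ← trans (sym eq) eq0

occursIn-cong : ∀ (c d : Clause n) l → lookup d (var l) ≡ lookup c (var l) →
                OccursIn c l → OccursIn d l
occursIn-cong c d (pos i) = trans
occursIn-cong c d (neg i) = trans

-- The same assignment works: a true literal of a clause sits at a nonzero letter, which `ψ`
-- retains.
satisfiable-mono : (φ ψ : Formula n m) →
                   (∀ j i → letter φ j i ≢ 0F → letter ψ j i ≡ letter φ j i) →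
                   Satisfiable φ → Satisfiable ψ
satisfiable-mono φ ψ mono (a , sat) = a , lookup⁻ λ j →
  let l , occ , true = lookup⁺ sat j
      c = lookup φ j
  in l , occursIn-cong c (lookup ψ j) l (mono j (var l) (occursIn⇒nonzero c l occ)) occ , true

nonzero? : ∀ (k : ℕ) (a : Fin 3) → Dec (a ≢ 0F)
nonzero? _ a = ¬? (a ≟ᶠ 0F)

-- The logogram of `SAT` and its minimal strings.

module _ {n m : ℕ} where

  private
    E F : Words (Fin 3)
    E = CNF n m
    F = SAT n m

  -- Such a string lies below a word of length `n * m`, which confines its domain; inclusions can
  -- then be checked block by block.
  Σ∞-position : ∀ g {k a} → g ∈ Σ∞ E → at g k ≡ just a →
                ∃₂ λ (j : Fin m) (i : Fin n) → position j i ≡ k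
  Σ∞-position g (x , x∈E , g≤x) eq = position-surjective
    (subst (_ <_) (trans x∈E (*-comm n m)) (letterAt-length x (≤-elim g ⌜ x ⌝ g≤x eq)))

  ≤-encode : ∀ g (φ : Formula n m) → g ∈ Σ∞ E →
             (∀ j i {a} → at g (position j i) ≡ just a → letter φ j i ≡ a) → g ≤ ⌜ encode φ ⌝
  ≤-encode g φ g∈Σ∞ agree = ≤-intro g ⌜ encode φ ⌝ go
    where
    go : ∀ {k a} → at g k ≡ just a → at ⌜ encode φ ⌝ k ≡ just a
    go eq with j , i , refl ← Σ∞-position g g∈Σ∞ eq =
      trans (at-position φ j i) (cong just (agree j i eq))

  ≤-encode⁻ : ∀ g (φ : Formula n m) → g ≤ ⌜ encode φ ⌝ →
              ∀ j i {a} → at g (position j i) ≡ just a → letter φ j i ≡ a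
  ≤-encode⁻ g φ g≤φ j i eq =
    just-injective (trans (sym (at-position φ j i)) (≤-elim g ⌜ encode φ ⌝ g≤φ eq))

  ≤-complete : ∀ f (φ : Formula n m) → f ∈ Σ∞ E → f ≤ ⌜ encode (complete f φ) ⌝
  ≤-complete f φ f∈Σ∞ = ≤-encode f (complete f φ) f∈Σ∞ λ j i eq →
    trans (letter-complete f φ j i) (cong (fromMaybe _) eq)

  -- The logogram yields a satisfiable `ψ` whose word is included in that of `φ`. Both words fill
  -- all positions, so their letters agree and `satisfiable-mono` applies.
  Log⇒satisfiable : ∀ g → g ∈ Log E F → (φ : Formula n m) → g ≤ ⌜ encode φ ⌝ → Satisfiable φ
  Log⇒satisfiable g (_ , covered) φ g≤φ
    with _ , a , (_ , (_ , ψ , refl , sat) , a≈ψ) , a≤φ ← covered {encode φ} (encode∈CNF φ) g≤φ =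
    satisfiable-mono ψ φ
      (λ j i _ → ≤-encode⁻ a φ a≤φ j i (trans (a≈ψ _) (at-position ψ j i))) sat

  -- Each word above `g` is itself the member of `F` that it has to include.
  satisfiable⇒Log : ∀ g → g ∈ Σ∞ E →
                    ((φ : Formula n m) → g ≤ ⌜ encode φ ⌝ → Satisfiable φ) → g ∈ Log E F
  satisfiable⇒Log g g∈Σ∞ sat = g∈Σ∞ , λ {x} → covered x
    where
    covered : ∀ x → x ∈ E → g ≤ ⌜ x ⌝ → x ∈ E ^ asStrings F
    covered x x∈E g≤x with φ , refl ← decode {n} {m} x x∈E =
      x∈E , ⌜ encode φ ⌝ , (encode φ , (x∈E , φ , refl , sat φ g≤x) , λ _ → refl) ,
      ≤-intro ⌜ encode φ ⌝ ⌜ encode φ ⌝ λ eq → eq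

  -- Overwriting `φ` by `f` gives a formula above `f`, hence satisfiable. It differs from `φ` only
  -- where `f` has a 0, and undoing those changes can only add literals.
  restrict-nonzero∈Log : ∀ f → f ∈ Log E F → restrict nonzero? f ∈ Log E F
  restrict-nonzero∈Log f f∈Log@(f∈Σ∞ , _) =
    satisfiable⇒Log f′ (Σ∞-≤ {E = E} f′ f (restrict-≤ nonzero? f) f∈Σ∞) λ φ f′≤φ →
      satisfiable-mono (complete f φ) φ (mono φ f′≤φ)
        (Log⇒satisfiable f f∈Log (complete f φ) (≤-complete f φ f∈Σ∞))
    where
    f′ : Str (Fin 3)
    f′ = restrict nonzero? f
    mono : ∀ φ → f′ ≤ ⌜ encode φ ⌝ →
           ∀ j i → letter (complete f φ) j i ≢ 0F → letter φ j i ≡ letter (complete f φ) j i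
    mono φ f′≤φ j i rewrite letter-complete f φ j i with at f (position j i) in eq
    ... | just a  = λ a≢0 → ≤-encode⁻ f′ φ f′≤φ j i (restrict⁺ nonzero? f eq a≢0)
    ... | nothing = λ _ → refl

  ReducedLog-nonzero : ∀ f → f ∈ ReducedLog E F → ∀ {k a} → at f k ≡ just a → a ≢ 0F
  ReducedLog-nonzero f f∈R =
    ReducedLog-restrict nonzero? {E} {F} f f∈R (restrict-nonzero∈Log f (proj₁ f∈R))

  ReducedLog-complete-empty : ∀ f g → f ∈ ReducedLog E F → g ∈ ReducedLog E F →
    f ≤ ⌜ encode {n} {m} (complete g empty) ⌝ → f ≈ g
  ReducedLog-complete-empty f g f∈R@(f∈Log@(f∈Σ∞ , _) , _) (_ , minimal) f≤φ =
    minimal {f} f∈Log (≤-intro f g go)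
    where
    go : ∀ {k a} → at f k ≡ just a → at g k ≡ just a
    go eq with j , i , refl ← Σ∞-position f f∈Σ∞ eq =
      complete-empty-nonzero g j i (≤-encode⁻ f (complete g empty) f≤φ j i eq)
        (ReducedLog-nonzero f f∈R eq)

  -- A minimal string below a satisfied formula.

  module Witness (φ : Formula n m) (assignment : Assignment n)
                 (satisfied : ∀ j → SatisfiesClause assignment (lookup φ j)) where

    chosen : Fin m → Fin n
    chosen j = var (proj₁ (satisfied j))

    Chosen : ℕ → Fin 3 → Set
    Chosen k _ = ∃[ j ] k ≡ position j (chosen j)

    chosen? : ∀ k a → Dec (Chosen k a)
    chosen? k _ = any? λ j → k ≟ⁿ position j (chosen j)

    witness : Str (Fin 3)
    witness = restrict chosen? ⌜ encode φ ⌝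

    witness-≤ : witness ≤ ⌜ encode φ ⌝
    witness-≤ = restrict-≤ chosen? ⌜ encode φ ⌝

    -- Every formula above the witness still has the chosen literal in each clause, so the one
    -- `assignment` satisfies them all.
    witness∈Log : witness ∈ Log E F
    witness∈Log = satisfiable⇒Log witness (encode φ , encode∈CNF φ , witness-≤) λ ψ w≤ψ →
      assignment , lookup⁻ λ j →
        let l , occ , true = satisfied j
            eq  = restrict⁺ chosen? ⌜ encode φ ⌝ (at-position φ j (chosen j)) (j , refl)
            ψ≡φ = ≤-encode⁻ witness ψ w≤ψ j (chosen j) eq
        in l , occursIn-cong (lookup φ j) (lookup ψ j) l ψ≡φ occ , true

    -- The completion of h by zeros satisfies clause j, so h has a letter in block
    -- j; being included in the witness, it can have one only at the chosen position.
    chosen∈Dom : ∀ h → h ∈ Log E F → h ≤ witness →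
                 ∀ j → ∃[ a ] at h (position j (chosen j)) ≡ just a
    chosen∈Dom h h∈Log@(h∈Σ∞ , _) h≤w j =
      let _ , sat     = Log⇒satisfiable h h∈Log (complete h empty) (≤-complete h empty h∈Σ∞)
          l , occ , _ = lookup⁺ sat j
          eq          = complete-empty-nonzero h j (var l) refl
                          (occursIn⇒nonzero (lookup (complete h empty) j) l occ)
          _ , j′ , k≡ = restrict⁻ chosen? ⌜ encode φ ⌝ (≤-elim h witness h≤w eq)
          j≡ , i≡     = position-injective j j′ (var l) (chosen j′) k≡
          i≡chosen    = trans i≡ (cong chosen (sym j≡))
      in letter (complete h empty) j (var l) ,
         subst (λ i → at h (position j i) ≡ just _) i≡chosen eq

    witness∈ReducedLog : witness ∈ ReducedLog E F
    witness∈ReducedLog = witness∈Log , λ {h} h∈Log h≤w →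
      ≤-antisym h witness h≤w (≤-intro witness h (go h h∈Log h≤w))
      where
      go : ∀ h → h ∈ Log E F → h ≤ witness →
           ∀ {k a} → at witness k ≡ just a → at h k ≡ just a
      go h h∈Log h≤w eq =
        let _ , j , k≡ = restrict⁻ chosen? ⌜ encode φ ⌝ eq
            b , eq′    = chosen∈Dom h h∈Log h≤w j
            eq″        = subst (λ k → at h k ≡ just b) (sym k≡) eq′
        -- The letter `b` found in `h` is that of the witness, because `h ≤ witness`.
        in trans eq″ (trans (sym (≤-elim h witness h≤w eq″)) eq)

  -- Completeness and irreducibility.

  ReducedLog-complete : Complete E F (ReducedLog E F)
  ReducedLog-complete = (λ f∈R → f∈R) , λ x∈E → mk⇔ to (from x∈E)
    where
    to : ∀ {x} → x ∈ F → ∃[ f ] f ∈ ReducedLog E F × f ≤ ⌜ x ⌝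
    to (_ , φ , refl , a , sat) = witness , witness∈ReducedLog , witness-≤
      where open Witness φ a (lookup⁺ sat)
    from : ∀ {x} → x ∈ E → ∃[ f ] f ∈ ReducedLog E F × f ≤ ⌜ x ⌝ → x ∈ F
    from {x} x∈E (f , (f∈Log , _) , f≤x) with φ , refl ← decode {n} {m} x x∈E =
      x∈E , φ , refl , Log⇒satisfiable f f∈Log φ f≤x

theorem10 : (n m : ℕ) .{{_ : NonZero n}} .{{_ : NonZero m}} →
    Irreducible (CNF n m) (SAT n m) (ReducedLog (CNF n m) (SAT n m))
theorem10 n m = ReducedLog-complete , λ K respects (_ , R⊈K) (K⊆R , covers) →
  -- Properness of `K` is contradicted by placing every minimal `g` in `K`.
  R⊈K λ {g} g∈R@(g∈Log@(g∈Σ∞ , _) , _) →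
    let φ             = complete {n} {m} g empty
        φ∈SAT         = encode∈CNF φ , φ , refl ,
                        Log⇒satisfiable g g∈Log φ (≤-complete {n} {m} g empty g∈Σ∞)
        f , f∈K , f≤φ = Equivalence.to (covers {encode φ} (encode∈CNF φ)) φ∈SAT
    -- The covering `f` equals `g` only up to `_≈_`; closure of `K` under `_≈_` brings in `g`
    -- itself.
    in respects (ReducedLog-complete-empty {n} {m} f g (K⊆R f∈K) g∈R f≤φ) f∈K
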